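{- Let $P$ be a finite bounded poset with minimum element $\hat 0$ and maximum element $\hat 1$, $\hat 0\ne\hat 1$. Let $Q$ be the quiver resulting from adding the directed edge $\hat 0\to\hat 1$ to the Hasse diagram $H(P)$. Then for the toric poset $[Q]$, $$\Psi_{\rm tor}^{[Q]}(\mathbf{x})=\frac{1}{x_{\hat 1}-x_{\hat 0}}\,\Psi^{P}(\mathbf{x}).$$
   Context: The Hasse diagram $H(P)$ is the quiver with an arc $i\to j$ for each cover relation $i\lessdot_P j$. (Quivers are simple, so if $\hat 0\to\hat 1$ is already in $H(P)$ then $Q=H(P)$.) Greene's rational function of a poset $P$ with $n$ elements is $\Psi^P(\mathbf{x})=\sum_{w\in\mathcal{L}(P)}\dfrac{1}{(x_{w_1}-x_{w_2})(x_{w_2}-x_{w_3})\cdots(x_{w_{n-1}}-x_{w_n})}$, where $\mathcal{L}(P)$ is the set of linear extensions $w=(w_1,\dots,w_n)$ of $P$ and $\mathbf{x}=(x_v)_{v\in P}$ are indeterminates. All quivers are finite directed graphs that are simple (no loops, no parallel or anti-parallel arcs) and acyclic, on a finite vertex set $V$ with $|V|=n$. A source is a vertex all of whose incident arcs point away from it; a sink is a vertex all of whose incident arcs point into it (an isolated vertex is both). A flip at a source or sink $k$ reverses all arcs incident to $k$. Two acyclic quivers are equivalent if they are related by a finite sequence of flips; the equivalence class $[Q]$ is called a toric poset; all its members have the same underlying undirected graph. A toric total order $[w]=[(w_1,\dots,w_n)]$ is the equivalence class of a permutation of $V$ under cyclic rotation. For a graph $G$ on $V$, let $\mathcal{A}_{\rm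 tor}(G)$ be the image in $\mathbb{R}^V/\mathbb{Z}^V$ of $\bigcup_{\{i,j\}\in G}\{x_i=x_j\}\subset\mathbb{R}^V$. A point of $\mathbb{R}^V/\mathbb{Z}^V-\mathcal{A}_{\rm tor}(G)$ determines an acyclic orientation of $G$: $i\to j$ if $x_i \bmod 1< x_j \bmod 1$ (values in $[0,1)$), and $j\to i$ otherwise. For a toric poset $[Q]$ with underlying graph $G$, its toric chamber $c_{[Q]}$ is the set of points whose orientation lies in $[Q]$ (these sets are exactly the connected components of $\mathbb{R}^V/\mathbb{Z}^V-\mathcal{A}_{\rm tor}(G)$). For a toric total order $[w]$, $c_{[w]}$ is the set of points with pairwise distinct coordinates such that listing the indices in increasing order of $x_i\bmod 1$ gives a member of $[w]$. $[w]$ is a toric total extension of $[Q]$ if $c_{[w]}\subseteq c_{[Q]}$; the set of these is $\mathcal{L}_{\rm tor}([Q])$. Define $\Psi_{\rm tor}^{[Q]}(\mathbf{x})=\sum_{[w]\in\mathcal{L}_{\rm tor}([Q])}\Psi_{\rm tor}^{[w]}(\mathbf{x})$, where $\Psi_{\rm tor}^{[w]}(\mathbf{x})=\dfrac{1}{(x_{w_1}-x_{w_2})(x_{w_2}-x_{w_3})\cdots(x_{w_{n-1}}-x_{w_n})(x_{w_n}-x_{w_1})}$. -}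

module Defs where

open import Level using (Level; 0ℓ; _⊔_) renaming (suc to lsuc)
open import Algebra.Apartness.Bundles using (HeytingField)
open import Data.Empty using (⊥-elim)
open import Data.Fin as Fin using (Fin)
import Data.Fin.Properties as Fin
open import Data.List using (List; []; _∷_; _++_; map; concatMap; filter; foldr; length; lookup; allFin)
open import Data.List.Relation.Binary.Permutation.Propositional using (_↭_)
open import Data.List.Relation.Unary.All using (All)
open import Data.List.Relation.Unary.AllPairs using (AllPairs)
open import Data.List.Relation.Unary.Any using (Any)
open import Data.List.Relation.Unary.Linked using (Linked)
open import Data.Nat using (ℕ)
open import Data.Product using (Σ-syntax; ∃; ∃-syntax; ∃₂; _×_; _,_; proj₁; proj₂)
open import Data.Rational as ℚ using (ℚ; 0ℚ; 1ℚ)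
import Data.Rational.Properties as ℚ
open import Data.Sum using (_⊎_; inj₁; inj₂)
open import Function using (_⇔_; module Equivalence)
open import Relation.Binary.Construct.Closure.Transitive using (TransClosure; [_]; _∷_)
import Relation.Binary.Construct.NonStrictToStrict as ToStrict
open import Relation.Binary.Core using (Rel)
open import Relation.Binary.Definitions using (Decidable; Tri; tri<; tri≈; tri>)
open import Relation.Binary.PropositionalEquality using (_≡_; _≢_; refl)
open import Relation.Binary.Structures using (IsDecPartialOrder)
open import Relation.Nullary using (¬_; Dec; yes; no)
open import Relation.Nullary.Decidable using (¬?; _×-dec_; _⊎-dec_; _→-dec_)
open import Relation.Unary using (Pred; _⊆_)

private
  variable
    a r p c ℓ₁ ℓ₂ : Level
    n : ℕ

-- Real numbers, as (two-sided, located) Dedekind cuts.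

record ℝ : Set₁ where
  field
    lower          : Pred ℚ 0ℓ
    upper          : Pred ℚ 0ℓ
    lower-nonempty : ∃ lower
    upper-nonempty : ∃ upper
    lower-rounded  : ∀ q → lower q ⇔ (∃[ s ] q ℚ.< s × lower s)
    upper-rounded  : ∀ q → upper q ⇔ (∃[ s ] s ℚ.< q × upper s)
    disjoint       : ∀ q → ¬ (lower q × upper q)
    located        : ∀ {q s} → q ℚ.< s → lower q ⊎ upper s

open ℝ public

infix 4 _<ℝ_

_<ℝ_ : Rel ℝ 0ℓ
u <ℝ v = ∃[ q ] upper u q × lower v q

<ℝ-trans : ∀ {u v w} → u <ℝ v → v <ℝ w → u <ℝ w
<ℝ-trans {u} {v} {w} (q , uq , vq) (s , vs , ws) with ℚ.<-cmp q s
... | tri< q<s _ _  = q , uq , Equivalence.from (lower-rounded w q) (s , q<s , ws)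
... | tri≈ _ refl _ = q , uq , ws
... | tri> _ _ s<q  =
  ⊥-elim (disjoint v s (Equivalence.from (lower-rounded v s) (q , s<q , vq) , vs))

<ℝ-irrefl : ∀ {u} → ¬ (u <ℝ u)
<ℝ-irrefl {u} (q , uq , lq) = disjoint u q (lq , uq)

-- The circle ℝ/ℤ, each class being given by its representative in [0,1).
-- In terms of cuts, 0 ≤ u says that every negative rational lies in the
-- lower cut of u, and u < 1 says that 1 lies in its upper cut.

record ℝ/ℤ : Set₁ where
  field
    mod1 : ℝ
    0≤   : ∀ q → q ℚ.< 0ℚ → lower mod1 q
    <1   : upper mod1 1ℚ

open ℝ/ℤ public

Torus : ℕ → Set₁
Torus n = Fin n → ℝ/ℤ

infix 4 _≺_ _≶_

_≺_ : Rel ℝ/ℤ 0ℓ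
s ≺ t = mod1 s <ℝ mod1 t

-- Distinctness in its positive form.

_≶_ : Rel ℝ/ℤ 0ℓ
s ≶ t = s ≺ t ⊎ t ≺ s

-- Acyclicity forbids directed cycles of length 1 and 2, that is, loops and
-- anti-parallel arcs.  Proofs of Arc i j are never counted, so there are no
-- parallel arcs.

record Quiver (n : ℕ) : Set₁ where
  field
    Arc     : Rel (Fin n) 0ℓ
    arc?    : Decidable Arc
    acyclic : ∀ {i} → ¬ TransClosure Arc i i

open Quiver public

_≐_ : Quiver n → Quiver n → Set
Q ≐ Q′ = ∀ i j → Arc Q i j ⇔ Arc Q′ i j

-- The underlying undirected graph.

Edge : Quiver n → Rel (Fin n) 0ℓ
Edge Q i j = Arc Q i j ⊎ Arc Q j i

IsSource IsSink : Quiver n → Pred (Fin n) 0ℓ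
IsSource Q k = ∀ i → ¬ Arc Q i k
IsSink   Q k = ∀ i → ¬ Arc Q k i

record Flip (k : Fin n) (Q Q′ : Quiver n) : Set where
  field
    source-or-sink : IsSource Q k ⊎ IsSink Q k
    reversed       : ∀ i j → i ≡ k ⊎ j ≡ k → Arc Q′ i j ⇔ Arc Q j i
    unchanged      : ∀ i j → i ≢ k → j ≢ k → Arc Q′ i j ⇔ Arc Q i j

-- Q ∼ Q′ : the quivers are related by a finite sequence of flips, i.e.
-- [Q] = [Q′].  A toric poset is handled through a representative, and
-- membership in [Q] is Q ∼_.

infix 4 _∼_

data _∼_ {n} : Rel (Quiver n) (lsuc 0ℓ) where
  done : ∀ {Q Q′} → Q ≐ Q′ → Q ∼ Q′
  step : ∀ {Q Q′ Q″} k → Flip k Q Q′ → Q′ ∼ Q″ → Q ∼ Q″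

-- The points outside the toric arrangement of the underlying graph of Q.

Off : Quiver n → Pred (Torus n) 0ℓ
Off Q t = ∀ i j → Edge Q i j → t i ≶ t j

module _ (Q : Quiver n) (t : Torus n) where

  OrientedArc : Rel (Fin n) 0ℓ
  OrientedArc i j = Edge Q i j × t i ≺ t j

  oriented⁺⇒≺ : ∀ {i j} → TransClosure OrientedArc i j → t i ≺ t j
  oriented⁺⇒≺ [ _ , i≺j ] = i≺j
  oriented⁺⇒≺ {i} {k} (_∷_ {y = j} (_ , i≺j) j⇝k) =
    <ℝ-trans {mod1 (t i)} {mod1 (t j)} {mod1 (t k)} i≺j (oriented⁺⇒≺ j⇝k)

  orientedArc? : Off Q t → Decidable OrientedArc
  orientedArc? off i j with arc? Q i j ⊎-dec arc? Q j i
  ... | no ¬e = no λ (e , _) → ¬e e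
  ... | yes e with off i j e
  ...   | inj₁ i≺j = yes (e , i≺j)
  ...   | inj₂ j≺i = no λ (_ , i≺j) →
    <ℝ-irrefl {mod1 (t i)} (<ℝ-trans {mod1 (t i)} {mod1 (t j)} {mod1 (t i)} i≺j j≺i)

  orientation : Off Q t → Quiver n
  orientation off = record
    { Arc     = OrientedArc
    ; arc?    = orientedArc? off
    ; acyclic = λ {i} i⇝i → <ℝ-irrefl {mod1 (t i)} (oriented⁺⇒≺ i⇝i)
    }

toricChamber : Quiver n → Pred (Torus n) (lsuc 0ℓ)
toricChamber Q t = Σ[ off ∈ Off Q t ] (Q ∼ orientation Q t off)

-- A total order (w₁,…,wₙ) is a list in which every vertex occurs exactly
-- once; a toric total order is such a list up to rotation.

IsTotalOrder : Pred (List (Fin n)) 0ℓ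
IsTotalOrder {n} w = w ↭ allFin n

_↻_ : {A : Set a} → Rel (List A) a
w ↻ w′ = ∃₂ λ us vs → w ≡ us ++ vs × w′ ≡ vs ++ us

totalChamber : List (Fin n) → Pred (Torus n) 0ℓ
totalChamber w t =
  (∀ i j → i ≢ j → t i ≶ t j) ×
  (∃[ w′ ] w ↻ w′ × Linked (λ i j → t i ≺ t j) w′)

Ltor : Quiver n → Pred (List (Fin n)) (lsuc 0ℓ)
Ltor Q w = IsTotalOrder w × totalChamber w ⊆ toricChamber Q

-- xs lists each class of elements of S modulo _≈_ exactly once.

record Transversal {A : Set a} (_≈_ : Rel A r) (S : Pred A p) (xs : List A)
                   : Set (a ⊔ r ⊔ p) where
  field
    sound     : All S xs
    complete  : ∀ {y} → S y → Any (y ≈_) xs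
    separated : AllPairs (λ y z → ¬ (y ≈ z)) xs

record FinPoset (n : ℕ) : Set₁ where
  infix 4 _≤_
  field
    _≤_               : Rel (Fin n) 0ℓ
    isDecPartialOrder : IsDecPartialOrder _≡_ _≤_

  open IsDecPartialOrder isDecPartialOrder public
    using (_≤?_; isPartialOrder)
  open ToStrict _≡_ _≤_ public using (_<_)

  _<?_ : Decidable _<_
  _<?_ = ToStrict.<-decidable _≡_ _≤_ Fin._≟_ _≤?_

  infix 4 _⋖_

  _⋖_ : Rel (Fin n) 0ℓ
  i ⋖ j = i < j × ¬ (∃[ k ] i < k × k < j)

  _⋖?_ : Decidable _⋖_
  i ⋖? j = (i <? j) ×-dec ¬? (Fin.any? λ k → (i <? k) ×-dec (k <? j))

  IsLinearExtension : Pred (List (Fin n)) 0ℓ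
  IsLinearExtension w = ∀ k l → lookup w k ≤ lookup w l → k Fin.≤ l

  isLinearExtension? : ∀ w → Dec (IsLinearExtension w)
  isLinearExtension? w =
    Fin.all? λ k → Fin.all? λ l → (lookup w k ≤? lookup w l) →-dec (k Fin.≤? l)

module _ (P : FinPoset n) where

  open FinPoset P

  ⁺⇒< : {_⟶_ : Rel (Fin n) 0ℓ} → (∀ {i j} → i ⟶ j → i < j) →
        ∀ {i j} → TransClosure _⟶_ i j → i < j
  ⁺⇒< ⟶⇒< [ i⟶j ]     = ⟶⇒< i⟶j
  ⁺⇒< ⟶⇒< (i⟶j ∷ j⇝k) =
    ToStrict.<-trans _≡_ _≤_ isPartialOrder (⟶⇒< i⟶j) (⁺⇒< ⟶⇒< j⇝k)

  hasse : Quiver n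
  hasse = record
    { Arc     = _⋖_
    ; arc?    = _⋖?_
    ; acyclic = λ i⇝i → proj₂ (⁺⇒< proj₁ i⇝i) refl
    }

  -- The Hasse diagram with one further arc u → v.

  hasse+ : ∀ {u v} → u < v → Quiver n
  hasse+ {u} {v} u<v = record
    { Arc     = λ i j → Arc hasse i j ⊎ (i ≡ u × j ≡ v)
    ; arc?    = λ i j → arc? hasse i j ⊎-dec ((i Fin.≟ u) ×-dec (j Fin.≟ v))
    ; acyclic = λ i⇝i → proj₂ (⁺⇒< arc⇒< i⇝i) refl
    }
    where
    arc⇒< : ∀ {i j} → i ⋖ j ⊎ (i ≡ u × j ≡ v) → i < j
    arc⇒< (inj₁ (i<j , _))     = i<j
    arc⇒< (inj₂ (refl , refl)) = u<v

insertions : {A : Set a} → A → List A → List (List A)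
insertions y []       = (y ∷ []) ∷ []
insertions y (z ∷ zs) = (y ∷ z ∷ zs) ∷ map (z ∷_) (insertions y zs)

permutations : {A : Set a} → List A → List (List A)
permutations []       = [] ∷ []
permutations (y ∷ ys) = concatMap (insertions y) (permutations ys)

linearExtensions : FinPoset n → List (List (Fin n))
linearExtensions {n} P = filter (FinPoset.isLinearExtension? P) (permutations (allFin n))

-- Rational functions whose poles lie on the hyperplanes xᵢ = xⱼ, at a family x
-- of pairwise distinct elements of a field F.  For F = k(x₁,…,xₙ) and
-- xᵢ the i-th indeterminate this is the rational function itself.

module Greene (F : HeytingField c ℓ₁ ℓ₂) (x : Fin n → HeytingField.Carrier F)
              (x-distinct : ∀ {i j} → i ≢ j → HeytingField._#_ F (x i) (x j)) where

  open HeytingField F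

  -- 1 / (xᵢ − xⱼ) for i ≠ j.  The value for i = j is arbitrary; it does not
  -- occur in Ψ, and occurs in Ψtor only when n = 1.

  1/[_-_] : Fin n → Fin n → Carrier
  1/[ i - j ] with i Fin.≟ j
  ... | yes _  = 0#
  ... | no i≢j = proj₁ (#⇒invertible (x-distinct i≢j))

  sum : List Carrier → Carrier
  sum = foldr _+_ 0#

  pathWeight : List (Fin n) → Carrier
  pathWeight []          = 1#
  pathWeight (_ ∷ [])    = 1#
  pathWeight (i ∷ j ∷ w) = 1/[ i - j ] * pathWeight (j ∷ w)

  -- 1 / ((x_{w₁} − x_{w₂}) ⋯ (x_{wₙ₋₁} − x_{wₙ}) (x_{wₙ} − x_{w₁}))

  cycleWeight : List (Fin n) → Carrier
  cycleWeight []      = 1#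
  cycleWeight (i ∷ w) = pathWeight ((i ∷ w) ++ i ∷ [])

  Ψ : FinPoset n → Carrier
  Ψ P = sum (map pathWeight (linearExtensions P))

  -- Ψtor Q s : the sum defining Ψ_tor of [Q] equals s.  The set of toric total
  -- extensions is not visibly decidable, so the sum is expressed by saying that
  -- this set is finite and that every choice of one representative per toric
  -- total extension gives the value s.

  Ψtor : Quiver n → Carrier → Set (lsuc 0ℓ ⊔ ℓ₁)
  Ψtor Q s =
    ∃ (Transversal _↻_ (Ltor Q)) ×
    (∀ ws → Transversal _↻_ (Ltor Q) ws → sum (map cycleWeight ws) ≈ s)

{-# OPTIONS --safe #-}
module Submission where

-- The linear extensions of P represent each toric total extension of [Q] exactly once, and
-- for such w = (0̂,…,1̂) the cyclic weight is the path weight times 1 / (x_1̂ − x_0̂).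
--
-- If w is a linear extension, w₁ is a source of Q, and flipping it yields a quiver compatible
-- with (w₂,…,wₙ,w₁); iterating, the chamber of [w] lies in that of [Q].
--
-- Conversely, rotate a toric total extension so that it starts with 0̂, and let R be the
-- orientation at a point of its chamber with coordinates increasing along it.  Counting the
-- flips from Q to R at each vertex gives f : V → ℤ such that an arc i → j of Q is kept in R
-- when f i = f j and reversed when f i = f j + 1.  So f is weakly decreasing along P, and
-- f 0̂ = f 1̂ because 0̂ is a source of R.  Hence f is constant and R = Q.

open import Defs
open import Algebra.Apartness.Bundles using (HeytingField)
open import Data.Fin as Fin using (Fin)
import Data.Fin.Induction as Fin
import Data.Fin.Properties as Fin
open import Data.Integer as ℤ using (ℤ; 0ℤ)
import Data.Integer.Properties as ℤ
open import Data.List using (List; []; _∷_; _++_; [_]; map; lookup; allFin)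
open import Data.List.Membership.Propositional using (_∈_; _∉_; lose; find)
open import Data.List.Membership.Propositional.Properties
  using (∈-∃++; ∈-map⁺; ∈-map⁻; ∈-concatMap⁺; ∈-concatMap⁻; ∈-filter⁺; ∈-filter⁻;
         ∈-lookup; ∈-allFin; ∈-insert)
open import Data.List.Properties
  using (++-assoc; ++-identityʳ; ∷-injective; ∷-injectiveˡ; ∷-injectiveʳ; tabulate-lookup)
open import Data.List.Relation.Binary.Permutation.Propositional
  using (_↭_; prep; ↭-refl; ↭-sym; ↭-trans; ↭⇒↭ₛ)
open import Data.List.Relation.Binary.Permutation.Propositional.Properties
  using (∈-resp-↭; ↭-empty-inv; drop-mid; shift; ++-comm)
import Data.List.Relation.Binary.Permutation.Setoid as Permₛ
import Data.List.Relation.Binary.Permutation.Setoid.Properties as ↭ₛ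
open import Data.List.Relation.Unary.All as All using (All; []; _∷_)
import Data.List.Relation.Unary.All.Properties as All
open import Data.List.Relation.Unary.AllPairs as AllPairs using (AllPairs; []; _∷_)
import Data.List.Relation.Unary.AllPairs.Properties as AllPairs
open import Data.List.Relation.Unary.Any as Any using (Any; here; there)
open import Data.List.Relation.Unary.Any.Properties using (lookup-index)
open import Data.List.Relation.Unary.Linked.Properties using (AllPairs⇒Linked; Linked⇒AllPairs)
open import Data.List.Relation.Unary.Unique.Propositional using (Unique)
import Data.List.Relation.Unary.Unique.Propositional.Properties as Unique
open import Data.Nat as ℕ using (ℕ; zero; suc)
import Data.Nat.Properties as ℕ
open import Data.Product using (Σ-syntax; ∃; ∃-syntax; _×_; _,_; proj₁; proj₂)
open import Data.Rational as ℚ using (ℚ; 0ℚ; 1ℚ)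
import Data.Rational.Properties as ℚ
open import Data.Sum using (_⊎_; inj₁; inj₂; [_,_]′)
open import Data.Vec.Functional using (updateAt)
open import Data.Vec.Functional.Properties using (updateAt-updates; updateAt-minimal)
open import Function using (_∘_; mk⇔; module Equivalence)
open import Induction.WellFounded using (Acc; acc)
open import Level using (Level; 0ℓ)
open import Relation.Binary.Bundles using (Setoid)
open import Relation.Binary.Construct.Closure.Transitive as Plus using (TransClosure)
open import Relation.Binary.Core using (Rel)
open import Relation.Binary.Definitions using (Maximum; Minimum; Reflexive; Symmetric; Transitive; tri<; tri≈; tri>)
open import Relation.Binary.PropositionalEquality
  using (_≡_; _≢_; refl; sym; trans; cong; subst; subst₂; setoid)
open import Relation.Nullary using (¬_; Dec; yes; no; contradiction)
open import Relation.Nullary.Decidable using (_×-dec_; _⊎-dec_; ¬?)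

private
  variable
    a r p c ℓ : Level
    A : Set a
    n : ℕ

-- Lists

module _ {R : Rel A r} where

  AllPairs-tabulate : ∀ ws → (∀ {k l} → k Fin.< l → R (lookup ws k) (lookup ws l)) → AllPairs R ws
  AllPairs-tabulate ws f = subst (AllPairs R) (tabulate-lookup ws) (AllPairs.tabulate⁺-< f)

  AllPairs-lookup : ∀ {ws} → AllPairs R ws → ∀ {k l} → k Fin.< l → R (lookup ws k) (lookup ws l)
  AllPairs-lookup (px ∷ _)  {Fin.zero}  {Fin.suc l} _         = All.lookup px (∈-lookup l)
  AllPairs-lookup (_ ∷ pxs) {Fin.suc k} {Fin.suc l} (ℕ.s≤s lt) = AllPairs-lookup pxs lt

  AllPairs-∈ : ∀ {ws} → AllPairs R ws → ∀ {u v} → u ∈ ws → v ∈ ws → u ≢ v → R u v ⊎ R v u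
  AllPairs-∈ (px ∷ pxs) (here refl) (here refl) u≢v = contradiction refl u≢v
  AllPairs-∈ (px ∷ pxs) (here refl) (there v∈)  u≢v = inj₁ (All.lookup px v∈)
  AllPairs-∈ (px ∷ pxs) (there u∈)  (here refl) u≢v = inj₂ (All.lookup px u∈)
  AllPairs-∈ (px ∷ pxs) (there u∈)  (there v∈)  u≢v = AllPairs-∈ pxs u∈ v∈ u≢v

  AllPairs-++⁻ʳ : ∀ us {vs} → AllPairs R (us ++ vs) → AllPairs R vs
  AllPairs-++⁻ʳ []       pxs       = pxs
  AllPairs-++⁻ʳ (u ∷ us) (_ ∷ pxs) = AllPairs-++⁻ʳ us pxs

Unique-lookup-injective : ∀ {ws : List A} → Unique ws → ∀ {k l} → lookup ws k ≡ lookup ws l → k ≡ l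
Unique-lookup-injective uniq {k} {l} eq with Fin.<-cmp k l
... | tri< k<l _ _ = contradiction eq (AllPairs-lookup uniq k<l)
... | tri≈ _ k≡l _ = k≡l
... | tri> _ _ l<k = contradiction (sym eq) (AllPairs-lookup uniq l<k)

Unique-resp-↭ : {ws zs : List A} → ws ↭ zs → Unique ws → Unique zs
Unique-resp-↭ {A = A} = ↭ₛ.Unique-resp-↭ (setoid A) ∘ ↭⇒↭ₛ

-- Lists without repetition over a setoid

module _ (S : Setoid c ℓ) where

  open Setoid S using (Carrier; _≈_) renaming (sym to ≈-sym; trans to ≈-trans)
  open Permₛ S using (↭-prep; ↭-swap)
    renaming (_↭_ to _↭ₛ_; ↭-refl to ↭ₛ-refl; ↭-sym to ↭ₛ-sym; ↭-trans to ↭ₛ-trans; prep to prepₛ)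
  import Data.List.Membership.Setoid S as S
  open import Data.List.Relation.Unary.Unique.Setoid S renaming (Unique to Uniqueₛ)

  ∈-extract : ∀ {v ws} → v S.∈ ws → ∃[ zs ] ws ↭ₛ v ∷ zs
  ∈-extract (here v≈w) = _ , prepₛ (≈-sym v≈w) ↭ₛ-refl
  ∈-extract {v} {w ∷ _} (there v∈ws) with ∈-extract v∈ws
  ... | zs , ws↭v∷zs = w ∷ zs , ↭ₛ-trans (↭-prep w ws↭v∷zs) (↭-swap w v ↭ₛ-refl)

  -- Applied with rotation as the equality, this makes two choices of representatives permutations
  -- of each other. The head of `ws` is pulled to the front of `zs`; its class recurs in neither
  -- tail, so both inclusions restrict to the tails.
  unique∧set⇒↭ : ∀ {ws zs} → Uniqueₛ ws → Uniqueₛ zs →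
                 (∀ {v} → v S.∈ ws → v S.∈ zs) → (∀ {v} → v S.∈ zs → v S.∈ ws) → ws ↭ₛ zs
  unique∧set⇒↭ {[]} {[]}    _ _ _ _ = ↭ₛ-refl
  unique∧set⇒↭ {[]} {_ ∷ _} _ _ _ ⊇ with () ← ⊇ (here (Setoid.refl S))
  unique∧set⇒↭ {w ∷ ws} {zs} (w∉ws ∷ ws!) zs! ⊆ ⊇ with ∈-extract (⊆ (here (Setoid.refl S)))
  ... | ys , zs↭w∷ys with ↭ₛ.Unique-resp-↭ S zs↭w∷ys zs!
  ... | w∉ys ∷ ys! = ↭ₛ-trans (↭-prep w (unique∧set⇒↭ ws! ys! ⊆′ ⊇′)) (↭ₛ-sym zs↭w∷ys)
    where
    ≉-∈ : ∀ {us v} → All (λ u → ¬ (w ≈ u)) us → v S.∈ us → ¬ (v ≈ w)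
    ≉-∈ (w≉u ∷ _) (here v≈u)   v≈w = w≉u (≈-trans (≈-sym v≈w) v≈u)
    ≉-∈ (_ ∷ w∉)  (there v∈us) v≈w = ≉-∈ w∉ v∈us v≈w

    ⊆′ : ∀ {v} → v S.∈ ws → v S.∈ ys
    ⊆′ v∈ws with ↭ₛ.∈-resp-↭ S zs↭w∷ys (⊆ (there v∈ws))
    ... | here v≈w   = contradiction v≈w (≉-∈ w∉ws v∈ws)
    ... | there v∈ys = v∈ys

    ⊇′ : ∀ {v} → v S.∈ ys → v S.∈ ws
    ⊇′ v∈ys with ⊇ (↭ₛ.∈-resp-↭ S (↭ₛ-sym zs↭w∷ys) (there v∈ys))
    ... | here v≈w   = contradiction v≈w (≉-∈ w∉ys v∈ys)
    ... | there v∈ws = v∈ws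

-- Rotation

↻-refl : Reflexive (_↻_ {A = A})
↻-refl {x = w} = [] , w , refl , sym (++-identityʳ w)

↻-sym : Symmetric (_↻_ {A = A})
↻-sym (us , vs , w≡ , z≡) = vs , us , z≡ , w≡

-- Levi's lemma: of two cuts of the same word one comes first, and `m` is the segment between them.
++-split : ∀ (us : List A) {vs} us′ {vs′} → us ++ vs ≡ us′ ++ vs′ →
           (∃[ m ] us ≡ us′ ++ m × vs′ ≡ m ++ vs) ⊎ (∃[ m ] us′ ≡ us ++ m × vs ≡ m ++ vs′)
++-split []       us′        eq = inj₂ (us′ , refl , eq)
++-split (u ∷ us) []         eq = inj₁ (u ∷ us , refl , sym eq)
++-split (u ∷ us) (u′ ∷ us′) eq with ∷-injective eq
... | refl , eq′ with ++-split us us′ eq′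
... | inj₁ (m , refl , q) = inj₁ (m , refl , q)
... | inj₂ (m , refl , q) = inj₂ (m , refl , q)

-- The middle word carries two cuts, one from each rotation. They divide it into three blocks, and
-- the composite rotation is again a single cut.
↻-trans : Transitive (_↻_ {A = A})
↻-trans (us , vs , refl , eq) (us′ , vs′ , eq′ , refl) with ++-split vs us′ (trans (sym eq) eq′)
... | inj₁ (m , refl , refl) = us ++ us′ , m , sym (++-assoc us us′ m) , ++-assoc m us us′
... | inj₂ (m , refl , refl) = m , vs′ ++ vs , ++-assoc m vs′ vs , sym (++-assoc vs′ vs m)

↻-setoid : (A : Set a) → Setoid a a
↻-setoid A = record
  { Carrier       = List A
  ; _≈_           = _↻_
  ; isEquivalence = record { refl = ↻-refl ; sym = ↻-sym ; trans = ↻-trans }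
  }

∈⇒↻∷ : ∀ {v : A} {w} → v ∈ w → ∃[ z ] w ↻ (v ∷ z)
∈⇒↻∷ {v = v} v∈w with ∈-∃++ v∈w
... | us , vs , refl = vs ++ us , us , v ∷ vs , refl , refl

-- A cut into two nonempty blocks would put `v` at the head of both, so `v` would occur twice.
Unique-∷-↻ : ∀ {v : A} {w z} → Unique (v ∷ w) → (v ∷ w) ↻ (v ∷ z) → v ∷ w ≡ v ∷ z
Unique-∷-↻ _ ([]     , vs     , refl , refl) = sym (++-identityʳ vs)
Unique-∷-↻ _ (u ∷ us , []     , refl , refl) = ++-identityʳ (u ∷ us)
Unique-∷-↻ (v∉w ∷ _) (_ ∷ us , _ ∷ vs , refl , refl) =
  contradiction refl (All.lookup v∉w (∈-insert us))

-- Enumeration of permutations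

∈-insertions⁺ : ∀ {y : A} us {vs} → us ++ y ∷ vs ∈ insertions y (us ++ vs)
∈-insertions⁺ []       {[]}    = here refl
∈-insertions⁺ []       {_ ∷ _} = here refl
∈-insertions⁺ (u ∷ us)         = there (∈-map⁺ (u ∷_) (∈-insertions⁺ us))

∈-insertions⇒↭ : ∀ {y : A} zs {w} → w ∈ insertions y zs → w ↭ y ∷ zs
∈-insertions⇒↭ []       (here refl) = ↭-refl
∈-insertions⇒↭ (z ∷ zs) (here refl) = ↭-refl
∈-insertions⇒↭ {y = y} (z ∷ zs) (there w∈) with ∈-map⁻ (z ∷_) w∈
... | w′ , w′∈ , refl =
  ↭-trans (prep z (∈-insertions⇒↭ zs w′∈)) (shift y [ z ] zs)

∈-permutations⁺ : ∀ (ws : List A) {w} → w ↭ ws → w ∈ permutations ws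
∈-permutations⁺ []       w↭ with refl ← ↭-empty-inv w↭ = here refl
∈-permutations⁺ (y ∷ ys) w↭ with ∈-∃++ (∈-resp-↭ (↭-sym w↭) (here refl))
... | us , vs , refl = ∈-concatMap⁺ (insertions y)
  (lose (∈-permutations⁺ ys (drop-mid us [] w↭)) (∈-insertions⁺ us))

∈-permutations⁻ : ∀ (ws : List A) {w} → w ∈ permutations ws → w ↭ ws
∈-permutations⁻ []       (here refl) = ↭-refl
∈-permutations⁻ (y ∷ ys) w∈ with find (∈-concatMap⁻ (insertions y) {xs = permutations ys} w∈)
... | zs , zs∈ , w∈′ = ↭-trans (∈-insertions⇒↭ zs w∈′) (prep y (∈-permutations⁻ ys zs∈))

insertions! : ∀ {y : A} zs → y ∉ zs → Unique (insertions y zs)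
insertions! []       _    = [] ∷ []
insertions! (z ∷ zs) y∉zs =
  All.tabulate (λ w∈ eq → let (_ , _ , w≡) = ∈-map⁻ (z ∷_) w∈ in
                y∉zs (here (∷-injectiveˡ (trans eq w≡)))) ∷
  Unique.map⁺ ∷-injectiveʳ (insertions! zs (y∉zs ∘ there))

-- Deleting `y` from `w` recovers the list it was inserted into. When only one of the two insertions
-- is at the front, `y` is the head of the other list, which is excluded.
insertions-injective : ∀ {y : A} us zs {w} → y ∉ us → y ∉ zs →
                       w ∈ insertions y us → w ∈ insertions y zs → us ≡ zs
insertions-injective []       []       _    _    _           _           = refl
insertions-injective []       (z ∷ zs) _    y∉zs (here refl) (there w∈)  with ∈-map⁻ (z ∷_) w∈
... | _ , _ , eq = contradiction (here (∷-injectiveˡ eq)) y∉zs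
insertions-injective (u ∷ us) []       y∉us _    (there w∈)  (here refl) with ∈-map⁻ (u ∷_) w∈
... | _ , _ , eq = contradiction (here (∷-injectiveˡ eq)) y∉us
insertions-injective (u ∷ us) (z ∷ zs) _    _    (here refl) (here eq)   = ∷-injectiveʳ eq
insertions-injective (u ∷ us) (z ∷ zs) _    y∉zs (here refl) (there w∈)  with ∈-map⁻ (z ∷_) w∈
... | _ , _ , eq = contradiction (here (∷-injectiveˡ eq)) y∉zs
insertions-injective (u ∷ us) (z ∷ zs) y∉us _    (there w∈)  (here refl) with ∈-map⁻ (u ∷_) w∈
... | _ , _ , eq = contradiction (here (∷-injectiveˡ eq)) y∉us
insertions-injective (u ∷ us) (z ∷ zs) y∉us y∉zs (there w∈)  (there w∈′)
  with ∈-map⁻ (u ∷_) w∈ | ∈-map⁻ (z ∷_) w∈′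
... | _ , v∈ , refl | _ , v∈′ , eq with ∷-injective eq
... | refl , refl = cong (u ∷_) (insertions-injective us zs (y∉us ∘ there) (y∉zs ∘ there) v∈ v∈′)

permutations! : {ws : List A} → Unique ws → Unique (permutations ws)
permutations! []                         = [] ∷ []
permutations! {ws = y ∷ ys} (y∉ys ∷ ys!) = Unique.concat⁺
  (All.map⁺ (All.tabulate λ zs∈ → insertions! _ (y∉ zs∈)))
  -- Blocks from different permutations of `ys` are disjoint: a common member would make these
  -- permutations equal.
  (AllPairs.map⁺ (AllPairs-tabulate (permutations ys) λ {k} {l} k<l {w} (w∈ , w∈′) →
    AllPairs-lookup (permutations! ys!) k<l
      (insertions-injective _ _ (y∉ (∈-lookup k)) (y∉ (∈-lookup l)) w∈ w∈′)))
  where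
  y∉ : ∀ {zs} → zs ∈ permutations ys → y ∉ zs
  y∉ zs∈ y∈zs = All.lookup y∉ys (∈-resp-↭ (∈-permutations⁻ ys zs∈) y∈zs) refl

-- Weights

module Weights {c ℓ₁ ℓ₂} (F : HeytingField c ℓ₁ ℓ₂) {n : ℕ} (x : Fin n → HeytingField.Carrier F)
               (x-distinct : ∀ {i j} → i ≢ j → HeytingField._#_ F (x i) (x j)) where

  open Greene F x x-distinct
  open HeytingField F hiding (refl; trans) renaming (sym to ≈-sym; setoid to 𝔽)
  open import Relation.Binary.Reasoning.Setoid 𝔽

  -- The path is cut at the vertex `v`, which belongs to both pieces, so each step lies in exactly
  -- one of them.
  pathWeight-++ : ∀ us v vs → pathWeight (us ++ v ∷ vs) ≈ pathWeight (us ++ [ v ]) * pathWeight (v ∷ vs)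
  pathWeight-++ []           v vs = ≈-sym (*-identityˡ _)
  pathWeight-++ (u ∷ [])     v vs = *-congʳ (≈-sym (*-identityʳ _))
  pathWeight-++ (u ∷ w ∷ us) v vs = begin
    1/[ u - w ] * pathWeight (w ∷ us ++ v ∷ vs)
      ≈⟨ *-congˡ (pathWeight-++ (w ∷ us) v vs) ⟩
    1/[ u - w ] * (pathWeight (w ∷ us ++ [ v ]) * pathWeight (v ∷ vs))
      ≈⟨ *-assoc _ _ _ ⟨
    1/[ u - w ] * pathWeight (w ∷ us ++ [ v ]) * pathWeight (v ∷ vs) ∎

  -- Two vertices divide the cycle into two paths. The product is symmetric in them, whence the
  -- invariance under rotation.
  cycleWeight-++ : ∀ u us v vs → cycleWeight (u ∷ us ++ v ∷ vs) ≈
                   pathWeight (u ∷ us ++ [ v ]) * pathWeight (v ∷ vs ++ [ u ])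
  cycleWeight-++ u us v vs = begin
    pathWeight (u ∷ (us ++ v ∷ vs) ++ [ u ])
      ≡⟨ cong (pathWeight ∘ (u ∷_)) (++-assoc us (v ∷ vs) [ u ]) ⟩
    pathWeight (u ∷ us ++ v ∷ vs ++ [ u ])
      ≈⟨ pathWeight-++ (u ∷ us) v (vs ++ [ u ]) ⟩
    pathWeight (u ∷ us ++ [ v ]) * pathWeight (v ∷ vs ++ [ u ]) ∎

  cycleWeight-↻ : ∀ {w z} → w ↻ z → cycleWeight w ≈ cycleWeight z
  cycleWeight-↻ ([]     , vs     , refl , refl) = reflexive (cong cycleWeight (sym (++-identityʳ vs)))
  cycleWeight-↻ (u ∷ us , []     , refl , refl) = reflexive (cong cycleWeight (++-identityʳ (u ∷ us)))
  cycleWeight-↻ (u ∷ us , v ∷ vs , refl , refl) = begin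
    cycleWeight (u ∷ us ++ v ∷ vs)                              ≈⟨ cycleWeight-++ u us v vs ⟩
    pathWeight (u ∷ us ++ [ v ]) * pathWeight (v ∷ vs ++ [ u ]) ≈⟨ *-comm _ _ ⟩
    pathWeight (v ∷ vs ++ [ u ]) * pathWeight (u ∷ us ++ [ v ]) ≈⟨ cycleWeight-++ v vs u us ⟨
    cycleWeight (v ∷ vs ++ u ∷ us)                              ∎

  -- The path from `v` back to `u` is the single closing step. With `u` and `v` the minimum and the
  -- maximum of the poset, it yields the factor in the theorem.
  cycleWeight-closing : ∀ u us v →
    cycleWeight (u ∷ us ++ [ v ]) ≈ 1/[ v - u ] * pathWeight (u ∷ us ++ [ v ])
  cycleWeight-closing u us v = begin
    cycleWeight (u ∷ us ++ [ v ])                      ≈⟨ cycleWeight-++ u us v [] ⟩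
    pathWeight (u ∷ us ++ [ v ]) * (1/[ v - u ] * 1#)  ≈⟨ *-congˡ (*-identityʳ _) ⟩
    pathWeight (u ∷ us ++ [ v ]) * 1/[ v - u ]         ≈⟨ *-comm _ _ ⟩
    1/[ v - u ] * pathWeight (u ∷ us ++ [ v ])         ∎

  sum-scale : ∀ {f g : A → Carrier} {k ws} → All (λ w → f w ≈ k * g w) ws →
              sum (map f ws) ≈ k * sum (map g ws)
  sum-scale {k = k} []      = ≈-sym (zeroʳ k)
  sum-scale {f = f} {g} {k} {w ∷ ws} (eq ∷ eqs) = begin
    f w + sum (map f ws)            ≈⟨ +-cong eq (sum-scale eqs) ⟩
    k * g w + k * sum (map g ws)    ≈⟨ distribˡ k _ _ ⟨
    k * (g w + sum (map g ws))      ∎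

  sum-cycleWeight-transversal : ∀ {S : List (Fin n) → Set p} {ws zs} →
    Transversal _↻_ S ws → Transversal _↻_ S zs → sum (map cycleWeight ws) ≈ sum (map cycleWeight zs)
  sum-cycleWeight-transversal tws tzs =
    ↭ₛ.foldr-commMonoid 𝔽 +-isCommutativeMonoid
      (↭ₛ.map⁺ (↻-setoid (Fin n)) 𝔽 cycleWeight-↻
        (unique∧set⇒↭ (↻-setoid (Fin n)) (separated tws) (separated tzs) (⊆-of tws tzs) (⊆-of tzs tws)))
    where
    open Transversal
    ⊆-of : ∀ {S : List (Fin n) → Set p} {ws zs} → Transversal _↻_ S ws → Transversal _↻_ S zs →
           ∀ {v} → Any (v ↻_) ws → Any (v ↻_) zs
    ⊆-of tws tzs v∈ws with find v∈ws
    ... | w , w∈ws , v↻w = Any.map (↻-trans v↻w) (complete tzs (All.lookup (sound tws) w∈ws))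

-- Total orders

totalOrder! : {w : List (Fin n)} → IsTotalOrder w → Unique w
totalOrder! {n} w↭ = Unique-resp-↭ (↭-sym w↭) (Unique.allFin⁺ n)

∈-totalOrder : {w : List (Fin n)} → IsTotalOrder w → ∀ i → i ∈ w
∈-totalOrder w↭ i = ∈-resp-↭ (↭-sym w↭) (∈-allFin i)

totalOrder-↻ : {w z : List (Fin n)} → w ↻ z → IsTotalOrder w → IsTotalOrder z
totalOrder-↻ (us , vs , refl , refl) w↭ = ↭-trans (++-comm vs us) w↭

-- Linear extensions and cover relations

module _ (P : FinPoset n) where

  open FinPoset P

  -- Induction on the interval from `i` to `j`: it is a cover, or some `k` strictly inside splits
  -- it. Each recursive call keeps one endpoint and moves the other inward, hence the two
  -- accessibility arguments.
  cover-rec : {R : Rel (Fin n) r} → Transitive R → (∀ {i j} → i ⋖ j → R i j) → ∀ {i j} → i < j → R i j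
  cover-rec {R = R} R-trans ⋖⇒R =
    go (Fin.po-noetherian isPartialOrder _) (Fin.po-wellFounded isPartialOrder _)
    where
    go : ∀ {i j} → Acc (λ k l → l < k) i → Acc _<_ j → i < j → R i j
    go {i} {j} (acc above) (acc below) i<j with Fin.any? (λ k → (i <? k) ×-dec (k <? j))
    ... | no  ∄k              = ⋖⇒R (i<j , ∄k)
    ... | yes (k , i<k , k<j) =
      R-trans (go (acc above) (below k<j) i<k) (go (above i<k) (acc below) k<j)

  -- The definition compares positions; its contrapositive is a pairwise condition, which suits
  -- recursion on the list and has the shape of `Compatible`.
  linearExtension⁺ : ∀ {w} → AllPairs (λ i j → ¬ j ≤ i) w → IsLinearExtension w
  linearExtension⁺ w↗ k l wk≤wl with k Fin.≤? l
  ... | yes k≤l = k≤l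
  ... | no  k≰l = contradiction wk≤wl (AllPairs-lookup w↗ (ℕ.≰⇒> k≰l))

  linearExtension⁻ : ∀ {w} → IsLinearExtension w → AllPairs (λ i j → ¬ j ≤ i) w
  linearExtension⁻ {w} lin = AllPairs-tabulate w λ {k} {l} k<l wl≤wk → ℕ.<⇒≱ k<l (lin l k wl≤wk)

  ∈-linearExtensions⁺ : ∀ {w} → IsTotalOrder w → IsLinearExtension w → w ∈ linearExtensions P
  ∈-linearExtensions⁺ w↭ = ∈-filter⁺ isLinearExtension? (∈-permutations⁺ (allFin n) w↭)

  ∈-linearExtensions⁻ : ∀ {w} → w ∈ linearExtensions P → IsTotalOrder w × IsLinearExtension w
  ∈-linearExtensions⁻ w∈ with ∈-filter⁻ isLinearExtension? {xs = permutations (allFin n)} w∈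
  ... | w∈perms , lin = ∈-permutations⁻ (allFin n) w∈perms , lin

  linearExtensions! : Unique (linearExtensions P)
  linearExtensions! = Unique.filter⁺ isLinearExtension? (permutations! (Unique.allFin⁺ n))

  -- A vertex before `0̂` would not lie above it, and a vertex after `1̂` would not lie below it.
  -- Neither kind exists.
  linearExtension-ends : ∀ {0̂ 1̂} → Minimum _≤_ 0̂ → Maximum _≤_ 1̂ → 0̂ ≢ 1̂ →
                         ∀ {w} → IsTotalOrder w → IsLinearExtension w → ∃[ us ] w ≡ 0̂ ∷ us ++ [ 1̂ ]
  linearExtension-ends {0̂} {1̂} 0̂-min 1̂-max 0̂≢1̂ {w} w↭ lin
    with w | linearExtension⁻ {w} lin | ∈-totalOrder w↭ 0̂ | ∈-totalOrder w↭ 1̂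
  ... | u ∷ _ | u↗ ∷ _   | there 0̂∈ | _         = contradiction (0̂-min u) (All.lookup u↗ 0̂∈)
  ... | _     | _        | here 0̂≡u | here 1̂≡u  = contradiction (trans 0̂≡u (sym 1̂≡u)) 0̂≢1̂
  ... | u ∷ _ | _  ∷ us↗ | here refl | there 1̂∈ with ∈-∃++ 1̂∈
  ... | us , []     , refl = us , refl
  ... | us , v ∷ vs , refl with AllPairs-++⁻ʳ us us↗
  ... | (v≰1̂ ∷ _) ∷ _ = contradiction (1̂-max v) v≰1̂

-- Flips

loopless : (Q : Quiver n) → ∀ {i j} → Arc Q i j → i ≢ j
loopless Q i→i refl = acyclic Q Plus.[ i→i ]

module _ (Q : Quiver n) (k : Fin n) where

  -- Arcs out of `k` are reversed and arcs into `k` dropped, so `k` becomes a sink and the result is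
  -- acyclic for every `k`. At a source nothing is dropped and this is the flip.
  SourceFlipArc : Rel (Fin n) 0ℓ
  SourceFlipArc i j = (j ≡ k × Arc Q k i) ⊎ (i ≢ k × j ≢ k × Arc Q i j)

  source-flip-sink : ∀ {j} → ¬ SourceFlipArc k j
  source-flip-sink (inj₁ (refl , k→k)) = loopless Q k→k refl
  source-flip-sink (inj₂ (k≢k , _))    = k≢k refl

  -- A path cannot pass through the new sink `k`, so one that ends elsewhere consists of arcs of `Q`
  -- only.
  source-flip-path : ∀ {i j} → j ≢ k → TransClosure SourceFlipArc i j → TransClosure (Arc Q) i j
  source-flip-path j≢k Plus.[ inj₁ (j≡k , _) ]        = contradiction j≡k j≢k
  source-flip-path j≢k Plus.[ inj₂ (_ , _ , i→j) ]    = Plus.[ i→j ]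
  source-flip-path j≢k (inj₂ (_ , _ , i→l) Plus.∷ l⇝j) = i→l Plus.∷ source-flip-path j≢k l⇝j
  source-flip-path j≢k (inj₁ (refl , _) Plus.∷ Plus.[ k→j ])   = contradiction k→j source-flip-sink
  source-flip-path j≢k (inj₁ (refl , _) Plus.∷ (k→l Plus.∷ _)) = contradiction k→l source-flip-sink

  source-flip : Quiver n
  source-flip = record
    { Arc     = SourceFlipArc
    ; arc?    = λ i j → ((j Fin.≟ k) ×-dec arc? Q k i) ⊎-dec
                        (¬? (i Fin.≟ k) ×-dec ¬? (j Fin.≟ k) ×-dec arc? Q i j)
    ; acyclic = λ {i} i⇝i → acyclic Q (source-flip-path (≢k i⇝i) i⇝i)
    }
    where
    ≢k : ∀ {i j} → TransClosure SourceFlipArc i j → i ≢ k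
    ≢k Plus.[ k→j ]      refl = source-flip-sink k→j
    ≢k (k→l Plus.∷ _)    refl = source-flip-sink k→l

  flip-source : IsSource Q k → Flip k Q source-flip
  flip-source k-source = record
    { source-or-sink = inj₁ k-source
    ; reversed       = λ where
        i j (inj₁ refl) → mk⇔ (λ k→j → contradiction k→j source-flip-sink)
                              (λ j→k → contradiction j→k (k-source j))
        i j (inj₂ refl) → mk⇔ (λ where (inj₁ (_ , k→i))     → k→i
                                       (inj₂ (_ , k≢k , _)) → contradiction refl k≢k)
                              (λ k→i → inj₁ (refl , k→i))
    ; unchanged      = λ i j i≢k j≢k → mk⇔
        (λ where (inj₁ (j≡k , _))     → contradiction j≡k j≢k
                 (inj₂ (_ , _ , i→j)) → i→j)
        (λ i→j → inj₂ (i≢k , j≢k , i→j))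
    }

  source-flip-edge⁺ : IsSource Q k → ∀ {i j} → Edge Q i j → Edge source-flip i j
  source-flip-edge⁺ k-source e = [ arc , [ inj₂ , inj₁ ]′ ∘ arc ]′ e
    where
    arc : ∀ {i j} → Arc Q i j → Edge source-flip i j
    arc {i} {j} i→j with i Fin.≟ k | j Fin.≟ k
    ... | yes refl | _        = inj₂ (inj₁ (refl , i→j))
    ... | no i≢k   | yes refl = contradiction i→j (k-source i)
    ... | no i≢k   | no j≢k   = inj₁ (inj₂ (i≢k , j≢k , i→j))

  source-flip-edge⁻ : ∀ {i j} → Edge source-flip i j → Edge Q i j
  source-flip-edge⁻ (inj₁ (inj₁ (refl , k→i)))    = inj₂ k→i
  source-flip-edge⁻ (inj₁ (inj₂ (_ , _ , i→j)))   = inj₁ i→j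
  source-flip-edge⁻ (inj₂ (inj₁ (refl , k→j)))    = inj₁ k→j
  source-flip-edge⁻ (inj₂ (inj₂ (_ , _ , j→i)))   = inj₂ j→i

-- For a total order `w`: `w` is a topological sort of `Q`.
Compatible : Quiver n → List (Fin n) → Set
Compatible Q w = AllPairs (λ i j → ¬ Arc Q j i) w

-- Graph and topological sort determine the quiver, since every edge must point forward along `w`.
compatible-≐ : (Q R : Quiver n) {w : List (Fin n)} → IsTotalOrder w → Compatible Q w → Compatible R w →
               (∀ {i j} → Edge Q i j → Edge R i j) → (∀ {i j} → Edge R i j → Edge Q i j) → Q ≐ R
compatible-≐ Q R w↭ Qw Rw Q⊆R R⊆Q i j = mk⇔ (arc Q R Qw Rw Q⊆R) (arc R Q Rw Qw R⊆Q)
  where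
  arc : ∀ Q R → Compatible Q _ → Compatible R _ → (∀ {i j} → Edge Q i j → Edge R i j) →
        Arc Q i j → Arc R i j
  arc Q R Qw Rw Q⊆R i→j with Q⊆R (inj₁ i→j)
  ... | inj₁ i→j′ = i→j′
  ... | inj₂ j→i
    with AllPairs-∈ (AllPairs.zip (Qw , Rw)) (∈-totalOrder w↭ i) (∈-totalOrder w↭ j) (loopless Q i→j)
  ... | inj₁ (_ , ¬j→i) = contradiction j→i ¬j→i
  ... | inj₂ (¬i→j , _) = contradiction i→j ¬i→j

compatible-∷-source : (Q : Quiver n) {k : Fin n} {w : List (Fin n)} → IsTotalOrder (k ∷ w) →
                      Compatible Q (k ∷ w) → IsSource Q k
compatible-∷-source Q kw↭ (k↗ ∷ _) i i→k with ∈-totalOrder kw↭ i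
... | here refl = loopless Q i→k refl
... | there i∈w = All.lookup k↗ i∈w i→k

-- Arcs among the vertices of `w` are unaffected, and `k` becomes a sink, so it may stand last.
compatible-source-flip : (Q : Quiver n) {k : Fin n} {w : List (Fin n)} → IsTotalOrder (k ∷ w) →
                         Compatible Q (k ∷ w) → Compatible (source-flip Q k) (w ++ [ k ])
compatible-source-flip Q {k} {w} kw↭ (_ ∷ Qw) with totalOrder! kw↭
... | k∉w ∷ _ = AllPairs.++⁺ (go k∉w Qw) ([] ∷ []) (All.tabulate λ _ → source-flip-sink Q k ∷ [])
  where
  go : ∀ {w} → All (k ≢_) w → Compatible Q w → Compatible (source-flip Q k) w
  go []          []         = []
  go (k≢i ∷ k∉w) (i↗ ∷ Qw) = All.zipWith (λ where
    (k≢j , ¬j→i) (inj₁ (i≡k , _))     → k≢i (sym i≡k)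
    (k≢j , ¬j→i) (inj₂ (_ , _ , j→i)) → ¬j→i j→i) (k∉w , i↗) ∷ go k∉w Qw

-- The vertices of `us` are flipped in turn. Each is the head of the current order, hence a source,
-- and moves to the end. Once `us` is exhausted, the current quiver and `R` share a graph and a
-- topological sort, so they agree.
compatible-rotate : (Q R : Quiver n) (us vs : List (Fin n)) → IsTotalOrder (us ++ vs) →
                    Compatible Q (us ++ vs) → Compatible R (vs ++ us) →
                    (∀ {i j} → Edge Q i j → Edge R i j) → (∀ {i j} → Edge R i j → Edge Q i j) → Q ∼ R
compatible-rotate Q R [] vs vs↭ Qvs Rvs Q⊆R R⊆Q =
  done (compatible-≐ Q R vs↭ Qvs (subst (Compatible R) (++-identityʳ vs) Rvs) Q⊆R R⊆Q)
compatible-rotate Q R (u ∷ us) vs w↭ Qw Rw Q⊆R R⊆Q =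
  step u (flip-source Q u u-source)
    (compatible-rotate (source-flip Q u) R us (vs ++ [ u ])
      (subst IsTotalOrder (++-assoc us vs [ u ]) (↭-trans (++-comm (us ++ vs) [ u ]) w↭))
      (subst (Compatible (source-flip Q u)) (++-assoc us vs [ u ]) (compatible-source-flip Q w↭ Qw))
      (subst (Compatible R) (sym (++-assoc vs [ u ] us)) Rw)
      (Q⊆R ∘ source-flip-edge⁻ Q u) (source-flip-edge⁺ Q u u-source ∘ R⊆Q))
  where
  u-source : IsSource Q u
  u-source = compatible-∷-source Q w↭ Qw

-- Chambers

≺-trans : Transitive _≺_
≺-trans {s} {t} {u} = <ℝ-trans {mod1 s} {mod1 t} {mod1 u}

≺-irrefl : ∀ {s} → ¬ s ≺ s
≺-irrefl {s} = <ℝ-irrefl {mod1 s}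

≺-asym : ∀ {s t} → s ≺ t → ¬ t ≺ s
≺-asym {s} {t} s≺t t≺s = ≺-irrefl {s} (≺-trans {s} {t} {s} s≺t t≺s)

Increasing : Torus n → List (Fin n) → Set
Increasing t w = AllPairs (λ i j → t i ≺ t j) w

increasing-distinct : ∀ {t : Torus n} {w} → IsTotalOrder w → Increasing t w → ∀ i j → i ≢ j → t i ≶ t j
increasing-distinct w↭ w↗ i j = AllPairs-∈ w↗ (∈-totalOrder w↭ i) (∈-totalOrder w↭ j)

orientation-compatible : (Q : Quiver n) {t : Torus n} (off : Off Q t) {w : List (Fin n)} →
                         Increasing t w → Compatible (orientation Q t off) w
orientation-compatible Q {t} _ = AllPairs.map λ {i} {j} i≺j (_ , j≺i) → ≺-asym {t i} {t j} i≺j j≺i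

-- At a point of the chamber the coordinates increase along some rotation of `w`. The orientation
-- there is compatible with that rotation, so `compatible-rotate` supplies the flips.
compatible⇒Ltor : (Q : Quiver n) {w : List (Fin n)} → IsTotalOrder w → Compatible Q w → Ltor Q w
compatible⇒Ltor Q {w} w↭ Qw = w↭ , chamber
  where
  chamber : ∀ {t} → totalChamber w t → toricChamber Q t
  chamber {t} (distinct , w′ , (us , vs , refl , refl) , w′↗) =
    off , compatible-rotate Q (orientation Q t off) us vs w↭ Qw
            (orientation-compatible Q {t} off (Linked⇒AllPairs (λ {i} {j} {k} → ≺-trans {t i} {t j} {t k}) w′↗))
            orient [ proj₁ , [ inj₂ , inj₁ ]′ ∘ proj₁ ]′
    where
    off : Off Q t
    off i j (inj₁ i→j) = distinct i j (loopless Q i→j)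
    off i j (inj₂ j→i) = distinct i j (loopless Q j→i ∘ sym)

    orient : ∀ {i j} → Edge Q i j → Edge (orientation Q t off) i j
    orient {i} {j} e = [ (λ i≺j → inj₁ (e , i≺j)) , (λ j≺i → inj₂ ([ inj₂ , inj₁ ]′ e , j≺i)) ]′ (off i j e)

-- Points with a prescribed order of coordinates

fromℚ : ℚ → ℝ
fromℚ q = record
  { lower          = ℚ._< q
  ; upper          = q ℚ.<_
  ; lower-nonempty = q ℚ.- 1ℚ , q-1<q
  ; upper-nonempty = q ℚ.+ 1ℚ , q<q+1
  ; lower-rounded  = λ s → mk⇔ ℚ.<-dense (λ (_ , s<u , u<q) → ℚ.<-trans s<u u<q)
  ; upper-rounded  = λ s → mk⇔ (λ q<s → let (u , q<u , u<s) = ℚ.<-dense q<s in u , u<s , q<u)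
                               (λ (_ , u<s , q<u) → ℚ.<-trans q<u u<s)
  ; disjoint       = λ s (s<q , q<s) → ℚ.<-asym s<q q<s
  ; located        = λ {s} {u} s<u → located′ s<u (ℚ._<?_ s q)
  }
  where
  q-1<q : q ℚ.- 1ℚ ℚ.< q
  q-1<q = subst (q ℚ.- 1ℚ ℚ.<_) (ℚ.+-identityʳ q) (ℚ.+-monoʳ-< q (ℚ.negative⁻¹ (ℚ.- 1ℚ)))

  q<q+1 : q ℚ.< q ℚ.+ 1ℚ
  q<q+1 = subst (ℚ._< q ℚ.+ 1ℚ) (ℚ.+-identityʳ q) (ℚ.+-monoʳ-< q (ℚ.positive⁻¹ 1ℚ))

  located′ : ∀ {s u} → s ℚ.< u → Dec (s ℚ.< q) → s ℚ.< q ⊎ q ℚ.< u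
  located′ s<u (yes s<q) = inj₁ s<q
  located′ s<u (no s≮q)  = inj₂ (ℚ.≤-<-trans (ℚ.≮⇒≥ s≮q) s<u)

-- Each term is chosen by density between its predecessor and 1, so the sequence increases strictly
-- and never leaves [0,1).
ascending : ℕ → Σ[ q ∈ ℚ ] 0ℚ ℚ.≤ q × q ℚ.< 1ℚ
ascending zero = 0ℚ , ℚ.≤-refl , ℚ.positive⁻¹ 1ℚ
ascending (suc k) with ascending k
... | q , 0≤q , q<1 with ℚ.<-dense q<1
... | s , q<s , s<1 = s , ℚ.<⇒≤ (ℚ.≤-<-trans 0≤q q<s) , s<1

ascending-< : ∀ {k l} → k ℕ.< l → proj₁ (ascending k) ℚ.< proj₁ (ascending l)
ascending-< = go ∘ ℕ.<⇒<′
  where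
  next : ∀ k → proj₁ (ascending k) ℚ.< proj₁ (ascending (suc k))
  next k = proj₁ (proj₂ (ℚ.<-dense (proj₂ (proj₂ (ascending k)))))

  go : ∀ {k l} → k ℕ.<′ l → proj₁ (ascending k) ℚ.< proj₁ (ascending l)
  go {k} (ℕ.<′-base)     = next k
  go (ℕ.<′-step {l} k<l) = ℚ.<-trans (go k<l) (next l)

position : ℕ → ℝ/ℤ
position k = record
  { mod1 = fromℚ (proj₁ (ascending k))
  ; 0≤   = λ q q<0 → ℚ.<-≤-trans q<0 (proj₁ (proj₂ (ascending k)))
  ; <1   = proj₂ (proj₂ (ascending k))
  }

position-≺ : ∀ {k l} → k ℕ.< l → position k ≺ position l
position-≺ k<l = ℚ.<-dense (ascending-< k<l)

-- Each vertex is placed at the term of `ascending` indexed by its position in `w`. The chamber of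
-- `w` is thus inhabited, so an inclusion of chambers can be evaluated at a point.
increasing-point : {w : List (Fin n)} → IsTotalOrder w → ∃[ t ] Increasing t w
increasing-point {n} {w} w↭ = point , AllPairs-tabulate w λ {k} {l} k<l →
  position-≺ (subst₂ ℕ._<_ (sym (rank-lookup k)) (sym (rank-lookup l)) k<l)
  where
  rank : Fin n → ℕ
  rank i = Fin.toℕ (Any.index (∈-totalOrder w↭ i))

  point : Torus n
  point i = position (rank i)

  rank-lookup : ∀ k → rank (lookup w k) ≡ Fin.toℕ k
  rank-lookup k = cong Fin.toℕ
    (Unique-lookup-injective (totalOrder! w↭) (sym (lookup-index (∈-totalOrder w↭ (lookup w k)))))

-- Potentials

-- f i counts the flips at i along a sequence from Q to R, those of sources positively and those
-- of sinks negatively.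
Potential : Quiver n → Quiver n → (Fin n → ℤ) → Set
Potential Q R f = ∀ i j → Arc Q i j →
  (Arc R i j × f i ≡ f j) ⊎ (Arc R j i × f i ≡ ℤ.suc (f j))

-- Only the value at `k` changes: up by one at a source, down by one at a sink. Being a source or
-- sink decides which arcs of `Q` at `k` are currently reversed.
potential-flip : {Q R R′ : Quiver n} {k : Fin n} {f : Fin n → ℤ} →
                 Potential Q R f → Flip k R R′ → ∃[ f′ ] Potential Q R′ f′
potential-flip {n} {Q} {R} {R′} {k} {f} pot flip = [ at-source , at-sink ]′ source-or-sink
  where
  open Flip flip

  reverse : ∀ {i j} → i ≡ k ⊎ j ≡ k → Arc R j i → Arc R′ i j
  reverse ∋k = Equivalence.from (reversed _ _ ∋k)

  bumped : (ℤ → ℤ) → Fin n → ℤ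
  bumped g = updateAt f k g

  bumped-k : ∀ g → bumped g k ≡ g (f k)
  bumped-k g = updateAt-updates k f

  bumped-≢ : ∀ g {i} → i ≢ k → bumped g i ≡ f i
  bumped-≢ g {i} i≢k = updateAt-minimal i k f i≢k

  away : ∀ g {i j} → i ≢ k → j ≢ k → Arc Q i j →
         (Arc R′ i j × bumped g i ≡ bumped g j) ⊎ (Arc R′ j i × bumped g i ≡ ℤ.suc (bumped g j))
  away g {i} {j} i≢k j≢k i→j rewrite bumped-≢ g i≢k | bumped-≢ g j≢k with pot i j i→j
  ... | inj₁ (i→j , eq) = inj₁ (Equivalence.from (unchanged i j i≢k j≢k) i→j , eq)
  ... | inj₂ (j→i , eq) = inj₂ (Equivalence.from (unchanged j i j≢k i≢k) j→i , eq)

  at-source : IsSource R k → ∃[ f′ ] Potential Q R′ f′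
  at-source k-source = bumped ℤ.suc , pot′
    where
    pot′ : Potential Q R′ (bumped ℤ.suc)
    pot′ i j i→j with i Fin.≟ k | j Fin.≟ k
    ... | no i≢k   | no j≢k   = away ℤ.suc i≢k j≢k i→j
    ... | yes refl | yes refl = contradiction refl (loopless Q i→j)
    -- An arc of `Q` out of `k` is still unreversed in `R`, as `k` is a source there; the flip
    -- reverses it.
    ... | yes refl | no j≢k   rewrite bumped-k ℤ.suc | bumped-≢ ℤ.suc j≢k with pot i j i→j
    ...   | inj₁ (k→j , eq) = inj₂ (reverse (inj₂ refl) k→j , cong ℤ.suc eq)
    ...   | inj₂ (j→k , _)  = contradiction j→k (k-source j)
    -- An arc of `Q` into `k` is already reversed in `R`; the flip restores it, and the increment
    -- closes the gap of one.
    pot′ i j i→j | no i≢k | yes refl rewrite bumped-k ℤ.suc | bumped-≢ ℤ.suc i≢k with pot i j i→j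
    ...   | inj₁ (i→k , _)  = contradiction i→k (k-source i)
    ...   | inj₂ (k→i , eq) = inj₁ (reverse (inj₂ refl) k→i , eq)

  at-sink : IsSink R k → ∃[ f′ ] Potential Q R′ f′
  at-sink k-sink = bumped ℤ.pred , pot′
    where
    pot′ : Potential Q R′ (bumped ℤ.pred)
    pot′ i j i→j with i Fin.≟ k | j Fin.≟ k
    ... | no i≢k   | no j≢k   = away ℤ.pred i≢k j≢k i→j
    ... | yes refl | yes refl = contradiction refl (loopless Q i→j)
    ... | yes refl | no j≢k   rewrite bumped-k ℤ.pred | bumped-≢ ℤ.pred j≢k with pot i j i→j
    ...   | inj₁ (k→j , _)  = contradiction k→j (k-sink j)
    ...   | inj₂ (j→k , eq) = inj₁ (reverse (inj₁ refl) j→k , trans (cong ℤ.pred eq) (ℤ.pred-suc (f j)))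
    pot′ i j i→j | no i≢k | yes refl rewrite bumped-k ℤ.pred | bumped-≢ ℤ.pred i≢k with pot i j i→j
    ...   | inj₁ (i→k , eq) = inj₂ (reverse (inj₁ refl) i→k , trans eq (sym (ℤ.suc-pred (f k))))
    ...   | inj₂ (k→i , _)  = contradiction k→i (k-sink i)

-- The zero function is a potential from `Q` to itself; it is then updated along the flips.
∼⇒potential : {Q R : Quiver n} → Q ∼ R → ∃ (Potential Q R)
∼⇒potential {Q = Q} = go {f = λ _ → 0ℤ} (λ i j i→j → inj₁ (i→j , refl))
  where
  go : ∀ {R R′ f} → Potential Q R f → R ∼ R′ → ∃ (Potential Q R′)
  go {f = f} pot (done R≐R′) = f , λ i j i→j → [
    (λ (i→j′ , eq) → inj₁ (Equivalence.to (R≐R′ i j) i→j′ , eq)) ,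
    (λ (j→i , eq) → inj₂ (Equivalence.to (R≐R′ j i) j→i , eq)) ]′ (pot i j i→j)
  go {f = f} pot (step k flip R∼R′) = go (proj₂ (potential-flip {Q = Q} {f = f} pot flip)) R∼R′

-- The quiver of a bounded poset

module Bounded (P : FinPoset n) {0̂ 1̂ : Fin n} (0̂-min : Minimum (FinPoset._≤_ P) 0̂)
               (1̂-max : Maximum (FinPoset._≤_ P) 1̂) (0̂≢1̂ : 0̂ ≢ 1̂) where

  open FinPoset P

  0̂<1̂ : 0̂ < 1̂
  0̂<1̂ = 0̂-min 1̂ , 0̂≢1̂

  Q : Quiver n
  Q = hasse+ P 0̂<1̂

  arc⇒< : ∀ {i j} → Arc Q i j → i < j
  arc⇒< (inj₁ (i<j , _))     = i<j
  arc⇒< (inj₂ (refl , refl)) = 0̂<1̂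

  -- All arcs of `Q`, including the added one, go up in `P`, so none runs backward along a linear
  -- extension.
  linearExtension⇒Ltor : ∀ {w} → IsTotalOrder w → IsLinearExtension w → Ltor Q w
  linearExtension⇒Ltor w↭ lin = compatible⇒Ltor Q w↭
    (AllPairs.map (λ j≰i j→i → j≰i (proj₁ (arc⇒< j→i))) (linearExtension⁻ P lin))

  source⇒unreversed : {R : Quiver n} → Q ∼ R → IsSource R 0̂ → ∀ {i j} → Arc Q i j → Arc R i j
  source⇒unreversed {R} Q∼R 0̂-source {i} {j} i→j with ∼⇒potential Q∼R
  ... | f , pot = [ proj₁ , (λ (_ , fi≡1+fj) → contradiction fi≤fj (1+fj≰fj fi≡1+fj)) ]′ (pot i j i→j)
    where
    antitone-< : ∀ {i j} → i < j → f j ℤ.≤ f i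
    antitone-< = cover-rec P (λ q p → ℤ.≤-trans p q) λ {i} {j} i⋖j →
      [ (λ (_ , eq) → ℤ.≤-reflexive (sym eq)) ,
        (λ (_ , eq) → subst (f j ℤ.≤_) (sym eq) (ℤ.i≤suc[i] (f j))) ]′ (pot i j (inj₁ i⋖j))

    antitone : ∀ {i j} → i ≤ j → f j ℤ.≤ f i
    antitone {i} {j} i≤j with i Fin.≟ j
    ... | yes refl = ℤ.≤-refl
    ... | no i≢j   = antitone-< (i≤j , i≢j)

    -- Here the added arc matters: its reversal would end at the source `0̂`, so it is kept and its
    -- ends have equal potential.
    f0̂≡f1̂ : f 0̂ ≡ f 1̂
    f0̂≡f1̂ = [ proj₂ , (λ (1̂→0̂ , _) → contradiction 1̂→0̂ (0̂-source 1̂)) ]′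
              (pot 0̂ 1̂ (inj₂ (refl , refl)))

    -- All values of `f` lie between those at `1̂` and `0̂`, which agree; no drop by one remains for
    -- a reversed arc.
    fi≤fj : f i ℤ.≤ f j
    fi≤fj = ℤ.≤-trans (antitone (0̂-min i)) (ℤ.≤-trans (ℤ.≤-reflexive f0̂≡f1̂) (antitone (1̂-max j)))

    1+fj≰fj : f i ≡ ℤ.suc (f j) → ¬ f i ℤ.≤ f j
    1+fj≰fj eq fi≤fj = ℤ.<-irrefl refl (ℤ.suc[i]≤j⇒i<j (subst (ℤ._≤ f j) eq fi≤fj))

  -- At a point increasing along `0̂ ∷ z` the orientation has `0̂` as a source, so it keeps every
  -- cover arc. Coordinates therefore increase along `P`, and the order of the coordinates extends
  -- that of `P`.
  Ltor⇒linearExtension : ∀ {w z} → Ltor Q w → w ↻ (0̂ ∷ z) → IsLinearExtension (0̂ ∷ z)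
  Ltor⇒linearExtension {w} {z} (w↭ , w⊆Q) w↻z with increasing-point (totalOrder-↻ w↻z w↭)
  ... | t , z↗ with w⊆Q {t} (increasing-distinct {t = t} (totalOrder-↻ w↻z w↭) z↗ ,
                             0̂ ∷ z , w↻z , AllPairs⇒Linked z↗)
  ... | off , Q∼R = linearExtension⁺ P
    (AllPairs.map (λ {i} {j} i≺j j≤i → ≺-irrefl {t i} (≺-≼-trans i≺j j≤i)) z↗)
    where
    R : Quiver n
    R = orientation Q t off

    0̂-source : IsSource R 0̂
    0̂-source = compatible-∷-source R (totalOrder-↻ w↻z w↭) (orientation-compatible Q {t} off z↗)

    monotone : ∀ {i j} → i < j → t i ≺ t j
    monotone = cover-rec P (λ {i} {j} {k} → ≺-trans {t i} {t j} {t k})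
      λ i⋖j → proj₂ (source⇒unreversed Q∼R 0̂-source (inj₁ i⋖j))

    ≺-≼-trans : ∀ {i j} → t i ≺ t j → j ≤ i → t i ≺ t i
    ≺-≼-trans {i} {j} i≺j j≤i with j Fin.≟ i
    ... | yes refl = i≺j
    ... | no j≢i   = ≺-trans {t i} {t j} {t i} i≺j (monotone (j≤i , j≢i))

  ends : ∀ {w} → w ∈ linearExtensions P → ∃[ us ] w ≡ 0̂ ∷ us ++ [ 1̂ ]
  ends w∈ with ∈-linearExtensions⁻ P w∈
  ... | w↭ , lin = linearExtension-ends P 0̂-min 1̂-max 0̂≢1̂ w↭ lin

  -- Completeness rotates a given order to start with `0̂`. Separation holds because all linear
  -- extensions start with `0̂`, so those in one rotation class coincide.
  linearExtensions-transversal : Transversal _↻_ (Ltor Q) (linearExtensions P)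
  linearExtensions-transversal = record
    { sound     = All.tabulate λ w∈ →
        let (w↭ , lin) = ∈-linearExtensions⁻ P w∈ in linearExtension⇒Ltor w↭ lin
    ; complete  = λ (w↭ , w⊆Q) → let (z , w↻z) = ∈⇒↻∷ (∈-totalOrder w↭ 0̂) in
        lose (∈-linearExtensions⁺ P (totalOrder-↻ w↻z w↭)
                                    (Ltor⇒linearExtension (w↭ , w⊆Q) w↻z)) w↻z
    ; separated = AllPairs-tabulate (linearExtensions P) λ {k} {l} k<l w↻z →
        AllPairs-lookup (linearExtensions! P) k<l (↻⇒≡ (∈-lookup k) (∈-lookup l) w↻z)
    }
    where
    ↻⇒≡ : ∀ {w z} → w ∈ linearExtensions P → z ∈ linearExtensions P → w ↻ z → w ≡ z
    ↻⇒≡ w∈ z∈ w↻z with ends w∈ | ends z∈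
    ... | us , refl | vs , refl =
      Unique-∷-↻ (totalOrder! (proj₁ (∈-linearExtensions⁻ P w∈))) w↻z

proposition4p1 : ∀ {c ℓ₁ ℓ₂} (F : HeytingField c ℓ₁ ℓ₂) (n : ℕ)
    (P : FinPoset n) (0̂ 1̂ : Fin n)
    (0̂-min : Minimum (FinPoset._≤_ P) 0̂) →
    Maximum (FinPoset._≤_ P) 1̂ →
    (0̂≢1̂ : 0̂ ≢ 1̂)
    (x : Fin n → HeytingField.Carrier F)
    (x-distinct : ∀ {i j} → i ≢ j → HeytingField._#_ F (x i) (x j)) →
    let open HeytingField F using (_*_)
        open Greene F x x-distinct
        Q = hasse+ P (0̂-min 1̂ , 0̂≢1̂)
    in Ψtor Q (1/[ 1̂ - 0̂ ] * Ψ P)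
proposition4p1 F n P 0̂ 1̂ 0̂-min 1̂-max 0̂≢1̂ x x-distinct =
  -- Any other transversal has the same sum as the linear extensions, where the closing factor comes
  -- out of every term.
  (linearExtensions P , linearExtensions-transversal) , λ ws ws-transversal →
    HeytingField.trans F
      (sum-cycleWeight-transversal ws-transversal linearExtensions-transversal)
      (sum-scale (All.tabulate closing))
  where
  open Bounded P 0̂-min 1̂-max 0̂≢1̂
  open HeytingField F using (_≈_; _*_)
  open Greene F x x-distinct
  open Weights F x x-distinct

  closing : ∀ {w} → w ∈ linearExtensions P → cycleWeight w ≈ 1/[ 1̂ - 0̂ ] * pathWeight w
  closing w∈ with ends w∈
  ... | us , refl = cycleWeight-closing 0̂ us 1̂
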